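{- Let $n\ge 1$. For every $r$ with $1\le r\le 2n+1$, $$|\mathcal D^r_{2n+1,0}|=(n!)^2\left\lceil\frac r2\right\rceil.$$
   Context: $\mathcal D^r_{2n+1,0}$ is the set of permutations $\sigma\in\mathfrak S_{2n+1}$ such that $\sigma(i)\le i$ whenever $i$ is even, and $\sigma(1)=r$. -}

module Defs where

open import Data.Fin using (Fin; zero; toℕ)
open import Data.Fin.Permutation using (Permutation′; _⟨$⟩ʳ_; _≈_)
open import Data.Nat using (ℕ; suc; _*_; _≤_)
open import Data.Nat.Divisibility using (_∣_)
open import Data.Product using (Σ; _×_; proj₁)
open import Function.Bundles using (Inverse)
open import Level using (Level; 0ℓ; _⊔_)
open import Relation.Binary.Bundles using (Setoid)
open import Relation.Binary.PropositionalEquality using (_≡_; refl; sym; trans; setoid)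

-- Fin m is zero-based; the element i stands for pos i of {1, …, m}.
pos : ∀ {m} → Fin m → ℕ
pos i = suc (toℕ i)

-- The conditions σ(i) ≤ i for even i, and σ(1) = r, for σ ∈ 𝔖₂ₙ₊₁.
InD : (n r : ℕ) → Permutation′ (suc (2 * n)) → Set
InD n r σ = (∀ i → 2 ∣ pos i → pos (σ ⟨$⟩ʳ i) ≤ pos i)
          × pos (σ ⟨$⟩ʳ zero) ≡ r

-- 𝒟ʳ₂ₙ₊₁,₀ as a setoid: permutations are records that also carry an inverse
-- and proofs, so two elements are identified when they agree as functions.
𝒟 : (n r : ℕ) → Setoid 0ℓ 0ℓ
𝒟 n r = record
  { Carrier       = Σ (Permutation′ (suc (2 * n))) (InD n r)
  ; _≈_           = λ σ τ → proj₁ σ ≈ proj₁ τ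
  ; isEquivalence = record
    { refl  = λ _ → refl
    ; sym   = λ p i → sym (p i)
    ; trans = λ p q i → trans (p i) (q i)
    }
  }

HasCardinality : ∀ {a ℓ : Level} → Setoid a ℓ → ℕ → Set (a ⊔ ℓ)
HasCardinality S k = Inverse S (setoid (Fin k))

{-# OPTIONS --safe #-}
module Submission where

-- Once σ(1) = r is fixed, the even position 2k has 2k admissible values, or
-- 2k − 1 when r ≤ 2k. Filling the even positions in increasing order, the k − 1
-- values already used are all admissible for 2k, so k + 1 choices remain if
-- 2k < r and k choices otherwise; the n odd positions left can then be filled in
-- n! ways. With c = ⌈r/2⌉ the even positions contribute
-- (2 ⋯ c) (c ⋯ n) = n! c.

open import Defs
open import Data.Fin using (Fin; zero; suc; toℕ; punchIn; combine; remQuot; inject≤; fromℕ<; cast)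
open import Data.Fin.Permutation
  using (Permutation; _⟨$⟩ʳ_; _⟨$⟩ˡ_; _≈_; id; flip; _∘ₚ_; remove; insert; punchIn-permute; cast-id)
  renaming (inverseˡ to ⟨$⟩ˡ∘⟨$⟩ʳ; inverseʳ to ⟨$⟩ʳ∘⟨$⟩ˡ)
open import Data.Fin.Properties
  using ( punchIn-injective; remQuot-combine; combine-remQuot; combine-surjective; *↔×
        ; toℕ-combine; toℕ-cast; toℕ-inject≤; toℕ-fromℕ<; toℕ-injective; toℕ<n; inject≤-injective)
open import Data.Nat
  using ( ℕ; zero; suc; _+_; _*_; _∸_; _⊓_; _^_; _≤_; _<_; _≤′_; ≤′-reflexive; ≤′-step
        ; z≤n; s≤s; s≤s⁻¹; z<s; s<s; _!; ⌊_/2⌋; ⌈_/2⌉)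
open import Data.Nat.Divisibility using (_∣_; _∣?_; ∣m+n∣m⇒∣n; n∣m*n)
open import Data.Nat.Properties
open import Data.Nat.Tactic.RingSolver using (solve-∀)
open import Data.Product using (Σ; ∃; _,_; proj₁; proj₂; uncurry)
open import Data.Product.Algebra using (×-comm)
open import Data.Sum using (inj₁; inj₂)
open import Function.Base using (_∘_; const)
open import Function.Bundles using (Inverse; Equivalence; _⇔_; mk⇔; _↔_)
open import Function.Consequences.Setoid using (strictlyInverseˡ⇒inverseˡ; strictlyInverseʳ⇒inverseʳ)
import Function.Construct.Composition as Composition
open import Function.Properties.Inverse using (↔-sym; ↔-trans)
open import Level using (0ℓ)
open import Relation.Binary.Bundles using (Setoid)
open import Relation.Binary.PropositionalEquality
  using (_≡_; refl; sym; trans; cong; cong₂; subst; setoid; module ≡-Reasoning)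
open import Relation.Nullary using (¬_; contradiction)
open import Relation.Nullary.Decidable using (from-no)

private variable
  m n k c : ℕ

-- Rook placements on boards and expansion along the first row.

Board : ℕ → ℕ → Set₁
Board m n = Fin m → Fin n → Set

Rooks : Board m n → Setoid 0ℓ 0ℓ
Rooks {m} {n} P = record
  { Carrier       = Σ (Permutation m n) λ σ → ∀ i → P i (σ ⟨$⟩ʳ i)
  ; _≈_           = λ σ τ → proj₁ σ ≈ proj₁ τ
  ; isEquivalence = record
    { refl  = λ _ → refl
    ; sym   = λ p i → sym (p i)
    ; trans = λ p q i → trans (p i) (q i)
    }
  }

mkInverse : ∀ {a b ℓ₁ ℓ₂} {S : Setoid a ℓ₁} {T : Setoid b ℓ₂}
            (let module S = Setoid S; module T = Setoid T)
            (to : S.Carrier → T.Carrier) (from : T.Carrier → S.Carrier) →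
            (∀ {x y} → x S.≈ y → to x T.≈ to y) →
            (∀ {x y} → x T.≈ y → from x S.≈ from y) →
            (∀ y → to (from y) T.≈ y) → (∀ x → from (to x) S.≈ x) →
            Inverse S T
mkInverse {S = S} {T = T} to from to-cong from-cong invˡ invʳ = record
  { to        = to
  ; from      = from
  ; to-cong   = to-cong
  ; from-cong = from-cong
  ; inverse   = (λ {x} {y} → strictlyInverseˡ⇒inverseˡ S T {f = to} {f⁻¹ = from} to-cong invˡ {x} {y})
              , (λ {x} {y} → strictlyInverseʳ⇒inverseʳ S T {f⁻¹ = from} {f = to} from-cong invʳ {x} {y})
  }

Rooks-reindex : {l : ℕ} (π : Permutation l m) {P : Board m n} {Q : Board l n} →
                (∀ i v → P (π ⟨$⟩ʳ i) v ⇔ Q i v) → Inverse (Rooks P) (Rooks Q)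
Rooks-reindex π {P} P⇔Q = mkInverse
  (λ (σ , p) → π ∘ₚ σ , λ i → Equivalence.to (P⇔Q i _) (p (π ⟨$⟩ʳ i)))
  (λ (τ , q) → flip π ∘ₚ τ , λ i →
    subst (λ j → P j (τ ⟨$⟩ʳ (π ⟨$⟩ˡ i))) (⟨$⟩ʳ∘⟨$⟩ˡ π) (Equivalence.from (P⇔Q _ _) (q (π ⟨$⟩ˡ i))))
  (λ σ≈τ i → σ≈τ _)
  (λ σ≈τ i → σ≈τ _)
  (λ (τ , _) i → cong (τ ⟨$⟩ʳ_) (⟨$⟩ˡ∘⟨$⟩ʳ π))
  (λ (σ , _) i → cong (σ ⟨$⟩ʳ_) (⟨$⟩ʳ∘⟨$⟩ˡ π))

remove-cong : (σ τ : Permutation (suc m) (suc n)) → σ ≈ τ → ∀ i → remove i σ ≈ remove i τ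
remove-cong σ τ σ≈τ i j = punchIn-injective (τ ⟨$⟩ʳ i) _ _ (begin
  punchIn (τ ⟨$⟩ʳ i) (remove i σ ⟨$⟩ʳ j) ≡⟨ cong (λ v → punchIn v (remove i σ ⟨$⟩ʳ j)) (σ≈τ i) ⟨
  punchIn (σ ⟨$⟩ʳ i) (remove i σ ⟨$⟩ʳ j) ≡⟨ punchIn-permute σ i j ⟨
  σ ⟨$⟩ʳ punchIn i j                     ≡⟨ σ≈τ (punchIn i j) ⟩
  τ ⟨$⟩ʳ punchIn i j                     ≡⟨ punchIn-permute τ i j ⟩
  punchIn (τ ⟨$⟩ʳ i) (remove i τ ⟨$⟩ʳ j) ∎)
  where open ≡-Reasoning

minor : Board (suc m) (suc n) → Fin (suc n) → Board m n
minor P v i w = P (suc i) (punchIn v w)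

-- As in Laplace expansion, a placement is a column for row `zero` together with a placement on the
-- minor. Here `f` enumerates the admissible columns; their minors all have the same count `c`, so
-- the sum over columns is `k * c`.
Rooks-expand : (P : Board (suc m) (suc n)) (f : Fin k → Fin (suc n)) →
               (∀ {a b} → f a ≡ f b → a ≡ b) →
               (∀ a → P zero (f a)) → (∀ v → P zero v → ∃ λ a → f a ≡ v) →
               (∀ a → HasCardinality (Rooks (minor P (f a))) c) →
               HasCardinality (Rooks P) (k * c)
Rooks-expand {m} {n} {k} {c} P f f-inj sound complete inv =
  mkInverse to from (λ {x} {y} → to-cong {x} {y}) (λ { refl _ → refl }) to∘from from∘to
  where
  open ≡-Reasoning
  module S = Setoid (Rooks P)
  module I a = Inverse (inv a)

  index : (x : S.Carrier) → ∃ λ a → f a ≡ proj₁ x ⟨$⟩ʳ zero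
  index (σ , p) = complete _ (p zero)

  rest : (x : S.Carrier) → Setoid.Carrier (Rooks (minor P (f (proj₁ (index x)))))
  rest x@(σ , p) = remove zero σ , λ i → subst (P (suc i)) (begin
    σ ⟨$⟩ʳ suc i                                     ≡⟨ punchIn-permute σ zero i ⟩
    punchIn (σ ⟨$⟩ʳ zero) (remove zero σ ⟨$⟩ʳ i)     ≡⟨ cong (λ v → punchIn v (remove zero σ ⟨$⟩ʳ i)) (proj₂ (index x)) ⟨
    punchIn (f (proj₁ (index x))) (remove zero σ ⟨$⟩ʳ i) ∎) (p (suc i))

  to : S.Carrier → Fin (k * c)
  to x = combine (proj₁ (index x)) (I.to _ (rest x))

  join : ∀ a → Fin c → S.Carrier
  join a y = insert zero (f a) (proj₁ τ) , λ
    { zero    → sound a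
    ; (suc i) → proj₂ τ i
    }
    where τ = I.from a y

  from : Fin (k * c) → S.Carrier
  from z = uncurry join (remQuot c z)

  -- As `x` and `y` live on minors indexed by `a` and `b`, they are compared through their
  -- underlying permutations.
  I-to-cong : ∀ {a b} (a≡b : a ≡ b) x y → proj₁ x ≈ proj₁ y → I.to a x ≡ I.to b y
  I-to-cong refl x y x≈y = I.to-cong _ {x} {y} x≈y

  to-cong : ∀ {x y} → x S.≈ y → to x ≡ to y
  to-cong {x} {y} x≈y = cong₂ combine a≡b
    (I-to-cong a≡b (rest x) (rest y) (remove-cong (proj₁ x) (proj₁ y) x≈y zero))
    where a≡b = f-inj (trans (proj₂ (index x)) (trans (x≈y zero) (sym (proj₂ (index y)))))

  to∘from : ∀ z → to (from z) ≡ z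
  to∘from z = trans (cong₂ combine index≡ (trans
      (I-to-cong index≡ (rest (from z)) (I.from a y) rest≈) (I.strictlyInverseˡ a y)))
    (combine-remQuot {k} c z)
    where
    a = proj₁ (remQuot {k} c z)
    y = proj₂ (remQuot {k} c z)
    index≡ : proj₁ (index (from z)) ≡ a
    index≡ = f-inj (proj₂ (index (from z)))
    rest≈ : proj₁ (rest (from z)) ≈ proj₁ (I.from a y)
    rest≈ i = punchIn-injective (f a) _ _ (sym (punchIn-permute (proj₁ (from z)) zero i))

  join-rest : ∀ x → join (proj₁ (index x)) (I.to _ (rest x)) S.≈ x
  join-rest x         zero    = proj₂ (index x)
  join-rest x@(σ , _) (suc i) = begin
    punchIn (f (proj₁ (index x))) (proj₁ (I.from _ (I.to _ (rest x))) ⟨$⟩ʳ i)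
      ≡⟨ cong₂ punchIn (proj₂ (index x)) (I.strictlyInverseʳ _ (rest x) i) ⟩
    punchIn (σ ⟨$⟩ʳ zero) (remove zero σ ⟨$⟩ʳ i)
      ≡⟨ punchIn-permute σ zero i ⟨
    σ ⟨$⟩ʳ suc i ∎

  from∘to : ∀ x → from (to x) S.≈ x
  from∘to x i = trans
    (cong (λ (a , y) → proj₁ (join a y) ⟨$⟩ʳ i) (remQuot-combine (proj₁ (index x)) (I.to _ (rest x))))
    (join-rest x i)

-- Column deletion and Ferrers boards.

-- The deleted column `v` is one of the `b + 1` values up to `b`, so `b` of them survive.
punchIn-≤⇔< : ∀ (v : Fin (suc n)) w {b} → toℕ v ≤ b → toℕ (punchIn v w) ≤ b ⇔ toℕ w < b
punchIn-≤⇔< zero    w       _         = mk⇔ (λ p → p) (λ p → p)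
punchIn-≤⇔< (suc v) zero    (s≤s _)   = mk⇔ (λ _ → s≤s z≤n) (λ _ → z≤n)
punchIn-≤⇔< (suc v) (suc w) (s≤s v≤b) = mk⇔
  (λ { (s≤s p) → s≤s (Equivalence.to (punchIn-≤⇔< v w v≤b) p) })
  (λ { (s≤s p) → s≤s (Equivalence.from (punchIn-≤⇔< v w v≤b) p) })

punchIn-<⇔< : ∀ (v : Fin (suc n)) w {b} → b ≤ toℕ v → toℕ (punchIn v w) < b ⇔ toℕ w < b
punchIn-<⇔< v       w       {zero}  _         = mk⇔ (λ ()) (λ ())
punchIn-<⇔< (suc v) zero    {suc b} _         = mk⇔ (λ _ → s≤s z≤n) (λ _ → s≤s z≤n)
punchIn-<⇔< (suc v) (suc w) {suc b} (s≤s b≤v) = mk⇔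
  (λ { (s≤s p) → s≤s (Equivalence.to (punchIn-<⇔< v w b≤v) p) })
  (λ { (s≤s p) → s≤s (Equivalence.from (punchIn-<⇔< v w b≤v) p) })

prod : ℕ → (ℕ → ℕ) → ℕ
prod zero    d = 1
prod (suc m) d = d 0 * prod m (d ∘ suc)

-- Row i has toℕ i + d (toℕ i) admissible columns; subtracting the i columns
-- taken by the earlier, shorter rows leaves d (toℕ i) choices.
Ferrers : (ℕ → ℕ) → Board m m
Ferrers d i v = toℕ v < toℕ i + d (toℕ i)

-- The hypothesis says that the row lengths `i + d i` of the Ferrers board never decrease, so the
-- first row is a shortest one.
staircase : ∀ (d : ℕ → ℕ) → (∀ i → d i ≤ suc (d (suc i))) → ∀ k → d 0 ≤ k + d k
staircase d mono zero    = ≤-refl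
staircase d mono (suc k) = begin
  d 0                   ≤⟨ staircase d mono k ⟩
  k + d k               ≤⟨ +-monoʳ-≤ k (mono k) ⟩
  k + suc (d (suc k))   ≡⟨ +-suc k _ ⟩
  suc k + d (suc k)     ∎
  where open ≤-Reasoning

-- The columns of the shortest row are admissible in every later row. Deleting any of them shortens
-- each later row by one and leaves the Ferrers board of `d ∘ suc`.
Ferrers-count : ∀ m d → (∀ i → d i ≤ suc (d (suc i))) → d m ≡ 0 →
                HasCardinality (Rooks (Ferrers {m} d)) (prod m d)
Ferrers-count zero d mono dm≡0 = mkInverse
  (λ _ → zero) (λ _ → id , λ ()) (λ _ → refl) (λ _ ()) (λ { zero → refl }) (λ _ ())
Ferrers-count (suc m) d mono dm≡0 = Rooks-expand (Ferrers d)
  (λ a → inject≤ a d0≤)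
  (inject≤-injective d0≤ d0≤ _ _)
  (λ a → v<d0 a)
  (λ v v<d0 → fromℕ< v<d0 , toℕ-injective (trans (toℕ-inject≤ _ d0≤) (toℕ-fromℕ< v<d0)))
  (λ a → Composition.inverse
    (Rooks-reindex id λ i w → mk⇔
      (λ { (s≤s p) → Equivalence.to (punchIn-≤⇔< (inject≤ a d0≤) w (a≤ a i)) p })
      (λ p → s≤s (Equivalence.from (punchIn-≤⇔< (inject≤ a d0≤) w (a≤ a i)) p)))
    (Ferrers-count m (d ∘ suc) (mono ∘ suc) dm≡0))
  where
  d0≤ : d 0 ≤ suc m
  -- As `d (suc m)` vanishes, the first row fits inside the board.
  d0≤ = subst (d 0 ≤_) (trans (cong (suc m +_) dm≡0) (+-identityʳ _)) (staircase d mono (suc m))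
  v<d0 : ∀ a → toℕ (inject≤ a d0≤) < d 0
  v<d0 a = subst (_< d 0) (sym (toℕ-inject≤ a d0≤)) (toℕ<n a)
  a≤ : ∀ a (i : Fin m) → toℕ (inject≤ a d0≤) ≤ toℕ i + d (suc (toℕ i))
  a≤ a i = s≤s⁻¹ (≤-trans (v<d0 a) (staircase d mono (suc (toℕ i))))

-- Evaluation of the product of choices.

prod-cong : ∀ m {d e} → (∀ i → i < m → d i ≡ e i) → prod m d ≡ prod m e
prod-cong zero    d≗e = refl
prod-cong (suc m) d≗e = cong₂ _*_ (d≗e 0 z<s) (prod-cong m λ i i<m → d≗e (suc i) (s<s i<m))

prod-+ : ∀ m n d → prod (m + n) d ≡ prod m d * prod n (d ∘ (m +_))
prod-+ zero    n d = sym (+-identityʳ _)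
prod-+ (suc m) n d = trans (cong (d 0 *_) (prod-+ m n (d ∘ suc))) (sym (*-assoc (d 0) _ _))

prod-suc : ∀ m d → prod (suc m) d ≡ prod m d * d m
prod-suc zero    d = *-comm (d 0) 1
prod-suc (suc m) d = trans (cong (d 0 *_) (prod-suc m (d ∘ suc))) (sym (*-assoc (d 0) _ _))

prod-∸≡! : ∀ m → prod m (m ∸_) ≡ m !
prod-∸≡! zero    = refl
prod-∸≡! (suc m) = cong (suc m *_) (prod-∸≡! m)

prod-suc≡! : ∀ m → prod m suc ≡ m !
prod-suc≡! zero    = refl
prod-suc≡! (suc m) = trans (prod-suc m suc) (trans (cong (_* suc m) (prod-suc≡! m)) (*-comm (m !) (suc m)))

𝟙[_<_] : ℕ → ℕ → ℕ
𝟙[ i     < zero  ] = 0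
𝟙[ zero  < suc h ] = 1
𝟙[ suc i < suc h ] = 𝟙[ i < h ]

𝟙-< : ∀ {i h} → i < h → 𝟙[ i < h ] ≡ 1
𝟙-< {zero}  (s≤s _)   = refl
𝟙-< {suc i} (s≤s i<h) = 𝟙-< i<h

𝟙-≥ : ∀ {i h} → h ≤ i → 𝟙[ i < h ] ≡ 0
𝟙-≥ z≤n       = refl
𝟙-≥ (s≤s h≤i) = 𝟙-≥ h≤i

𝟙≤1 : ∀ i h → 𝟙[ i < h ] ≤ 1
𝟙≤1 i       zero    = z≤n
𝟙≤1 zero    (suc h) = ≤-refl
𝟙≤1 (suc i) (suc h) = 𝟙≤1 i h

-- At `n = h` every factor carries the indicator and the product is `(h + 1)!`; each further factor
-- is the plain `n + 1` that extends the factorial.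
prod-𝟙 : ∀ {h n} → h ≤′ n → prod n (λ i → suc i + 𝟙[ i < h ]) ≡ n ! * suc h
prod-𝟙 {h} (≤′-reflexive refl) = begin
  prod h (λ i → suc i + 𝟙[ i < h ]) ≡⟨ prod-cong h (λ i i<h → trans (cong (suc i +_) (𝟙-< i<h)) (+-comm (suc i) 1)) ⟩
  prod h (λ i → suc (suc i))        ≡⟨ *-identityˡ _ ⟨
  prod (suc h) suc                  ≡⟨ prod-suc≡! (suc h) ⟩
  suc h * h !                       ≡⟨ *-comm (suc h) (h !) ⟩
  h ! * suc h                       ∎
  where open ≡-Reasoning
prod-𝟙 {h} (≤′-step {n} h≤′n) = begin
  prod (suc n) e                    ≡⟨ prod-suc n e ⟩
  prod n e * (suc n + 𝟙[ n < h ])   ≡⟨ cong₂ _*_ (prod-𝟙 h≤′n) (trans (cong (suc n +_) (𝟙-≥ (≤′⇒≤ h≤′n))) (+-identityʳ _)) ⟩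
  n ! * suc h * suc n               ≡⟨ *-comm (n ! * suc h) (suc n) ⟩
  suc n * (n ! * suc h)             ≡⟨ *-assoc (suc n) (n !) (suc h) ⟨
  suc n ! * suc h                   ∎
  where
  open ≡-Reasoning
  e = λ i → suc i + 𝟙[ i < h ]

-- The first n rows are the even positions: row i is position 2 i + 2, which has
-- lost the value r exactly when r ≤ 2 i + 2, that is, when h = ⌊ (r − 1) / 2 ⌋ ≤ i.
-- The remaining n rows are unrestricted. Each of the two formulas is the smaller
-- one on its own range, so ⊓ replaces a case distinction.
choices : ℕ → ℕ → ℕ → ℕ
choices n h i = (suc i + 𝟙[ i < h ]) ⊓ (2 * n ∸ i)

∸-step : ∀ m i → m ∸ i ≤ suc (m ∸ suc i)
∸-step zero    i       = subst (_≤ 1) (sym (0∸n≡0 i)) z≤n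
∸-step (suc m) zero    = ≤-refl
∸-step (suc m) (suc i) = ∸-step m i

-- This is the hypothesis of `Ferrers-count`, proved for each argument of the minimum. In the first,
-- the growth of `suc i` makes up for a vanishing indicator.
choices-step : ∀ n h i → choices n h i ≤ suc (choices n h (suc i))
choices-step n h i = ⊓-mono-≤
  (s≤s (≤-trans (+-monoʳ-≤ i (𝟙≤1 i h))
    (≤-trans (≤-reflexive (+-comm i 1)) (s≤s (m≤n⇒m≤1+n (m≤m+n i _))))))
  (∸-step (2 * n) i)

choices-end : ∀ n h → choices n h (2 * n) ≡ 0
choices-end n h = trans (cong (e ⊓_) (n∸n≡0 (2 * n))) (⊓-zeroʳ e)
  where e = suc (2 * n) + 𝟙[ 2 * n < h ]

prod-choices : ∀ n h → h ≤ n → prod (2 * n) (choices n h) ≡ (n !) ^ 2 * suc h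
prod-choices n h h≤n = begin
  prod (2 * n) (choices n h)
    ≡⟨ prod-+ n (n + 0) (choices n h) ⟩
  prod n (choices n h) * prod (n + 0) (choices n h ∘ (n +_))
    ≡⟨ cong₂ _*_ (prod-cong n low) (prod-cong (n + 0) high) ⟩
  prod n (λ i → suc i + 𝟙[ i < h ]) * prod (n + 0) ((n + 0) ∸_)
    ≡⟨ cong₂ _*_ (prod-𝟙 (≤⇒≤′ h≤n)) (trans (prod-∸≡! (n + 0)) (cong _! (+-identityʳ n))) ⟩
  n ! * suc h * n !
    ≡⟨ rearrange (n !) (suc h) ⟩
  (n !) ^ 2 * suc h ∎
  where
  open ≡-Reasoning
  rearrange : ∀ a b → a * b * a ≡ a * (a * 1) * b
  rearrange = solve-∀
  low : ∀ i → i < n → choices n h i ≡ suc i + 𝟙[ i < h ]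
  -- As the indicator is at most 1, it suffices that `suc i + 1 + i`, which is `2 * suc i`, is at
  -- most `2 * n`.
  low i i<n = m≤n⇒m⊓n≡m (m+n≤o⇒m≤o∸n (suc i + 𝟙[ i < h ])
    (≤-trans (+-monoˡ-≤ i (+-monoʳ-≤ (suc i) (𝟙≤1 i h)))
      (≤-trans (≤-reflexive (twice i)) (*-monoʳ-≤ 2 i<n))))
    where
    twice : ∀ i → suc i + 1 + i ≡ 2 * suc i
    twice = solve-∀
  high : ∀ i → i < n + 0 → choices n h (n + i) ≡ n + 0 ∸ i
  high i _ = trans
    (cong ((suc (n + i) + 𝟙[ n + i < h ]) ⊓_) ([m+n]∸[m+o]≡n∸o n (n + 0) i))
    (m≥n⇒m⊓n≡n (≤-trans (m∸n≤m (n + 0) i) (≤-trans (≤-reflexive (+-identityʳ n))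
      (≤-trans (m≤m+n n i) (≤-trans (n≤1+n _) (m≤m+n _ _))))))

-- From the permutations to a Ferrers board.

⌊/2⌋≤⇒≤ : ∀ r j → ⌊ r /2⌋ ≤ j → r ≤ suc (j * 2)
⌊/2⌋≤⇒≤ zero          j       _       = z≤n
⌊/2⌋≤⇒≤ (suc zero)    j       _       = s≤s z≤n
⌊/2⌋≤⇒≤ (suc (suc r)) (suc j) (s≤s p) = s≤s (s≤s (⌊/2⌋≤⇒≤ r j p))

≤⌊/2⌋⇒≤ : ∀ r k → k ≤ ⌊ r /2⌋ → k * 2 ≤ r
≤⌊/2⌋⇒≤ r             zero    _       = z≤n
≤⌊/2⌋⇒≤ (suc (suc r)) (suc k) (s≤s p) = s≤s (s≤s (≤⌊/2⌋⇒≤ r k p))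

-- The bound `suc (j * 2)` allows `2 j + 2` values. The deleted column `r` is one of them exactly
-- when `⌊ toℕ r /2⌋ ≤ j`, and then one fewer remains; the indicator records the other case.
punchIn-≤-odd⇔ : ∀ (r : Fin (suc m)) (w : Fin m) j →
                 toℕ (punchIn r w) ≤ suc (j * 2) ⇔ toℕ w < suc (j * 2) + 𝟙[ j < ⌊ toℕ r /2⌋ ]
punchIn-≤-odd⇔ r w j with ≤-<-connex ⌊ toℕ r /2⌋ j
... | inj₁ h≤j rewrite 𝟙-≥ h≤j | +-identityʳ (j * 2) =
  punchIn-≤⇔< r w (⌊/2⌋≤⇒≤ (toℕ r) j h≤j)
... | inj₂ j<h rewrite 𝟙-< j<h | +-comm (j * 2) 1 = mk⇔
  (λ p → Equivalence.to e (s≤s p)) (λ p → s≤s⁻¹ (Equivalence.from e p))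
  where e = punchIn-<⇔< r w (≤⌊/2⌋⇒≤ (toℕ r) (suc j) j<h)

-- Since `w < N ≤ i + (N ∸ i)`, capping the choices at `N ∸ i` excludes no column.
<-+-⊓-∸⇔ : ∀ {w N} i c → w < N → w < i + c ⇔ w < i + (c ⊓ (N ∸ i))
<-+-⊓-∸⇔ {w} {N} i c w<N = mk⇔
  (λ p → subst (w <_) (sym (+-distribˡ-⊓ i c (N ∸ i))) (⊓-pres-m< p (<-≤-trans w<N (m≤n+m∸n N i))))
  (λ p → <-≤-trans p (+-monoʳ-≤ i (m⊓n≤m c (N ∸ i))))

-- Transposing a 2 by `n` grid sends index `a n + j` to `2 j + a`. The minor starts at position 2,
-- so its zero-based even rows, listed first, are the even positions.
evensFirst : ∀ n → Permutation (2 * n) (2 * n)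
evensFirst n = *↔× {2} {n} ∙ ×-comm (Fin 2) (Fin n) ∙ ↔-sym *↔× ∙ cast-id (*-comm n 2)
  where
  infixr 9 _∙_
  _∙_ : ∀ {A B C : Set} → A ↔ B → B ↔ C → A ↔ C
  _∙_ = ↔-trans

toℕ-evensFirst : ∀ n (a : Fin 2) (j : Fin n) → toℕ (evensFirst n ⟨$⟩ʳ combine a j) ≡ toℕ j * 2 + toℕ a
toℕ-evensFirst n a j = begin
  toℕ (evensFirst n ⟨$⟩ʳ combine a j)   ≡⟨ cong (λ (b , i) → toℕ (cast (*-comm n 2) (combine i b))) (remQuot-combine a j) ⟩
  toℕ (cast (*-comm n 2) (combine j a)) ≡⟨ toℕ-cast (*-comm n 2) (combine j a) ⟩
  toℕ (combine j a)                     ≡⟨ toℕ-combine j a ⟩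
  2 * toℕ j + toℕ a                     ≡⟨ cong (_+ toℕ a) (*-comm 2 (toℕ j)) ⟩
  toℕ j * 2 + toℕ a                     ∎
  where open ≡-Reasoning

𝒟-board : ∀ n → ℕ → Board (suc (2 * n)) (suc (2 * n))
𝒟-board n r zero      v = pos v ≡ r
𝒟-board n r i@(suc _) v = 2 ∣ pos i → pos v ≤ pos i

𝒟↔Rooks : ∀ n r → Inverse (𝒟 n r) (Rooks (𝒟-board n r))
𝒟↔Rooks n r = mkInverse
  (λ (σ , even , first) → σ , λ { zero → first ; (suc i) → even (suc i) })
  (λ (σ , p) → σ , (λ { zero 2∣1 → contradiction 2∣1 (from-no (2 ∣? 1)) ; (suc i) → p (suc i) }) , p zero)
  (λ p → p) (λ p → p) (λ _ _ → refl) (λ _ _ → refl)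

2∤odd : ∀ j → ¬ 2 ∣ suc (j * 2)
2∤odd j 2∣ = contradiction (∣m+n∣m⇒∣n (subst (2 ∣_) (+-comm 1 (j * 2)) 2∣) (n∣m*n j)) (from-no (2 ∣? 1))

-- At an even position, the bound from `punchIn-≤-odd⇔` is regrouped as row index plus choices. An
-- odd position admits every column, and its Ferrers row is long enough to do the same.
minor-𝒟⇔Ferrers : ∀ n (r : Fin (suc (2 * n))) i w →
  minor (𝒟-board n (pos r)) r (evensFirst n ⟨$⟩ʳ i) w ⇔ Ferrers (choices n ⌊ toℕ r /2⌋) i w
minor-𝒟⇔Ferrers n r i w with combine-surjective {2} {n} i
... | zero , j , refl = even (toℕ-evensFirst n zero j) (trans (toℕ-combine {2} zero j) (cong (_+ toℕ j) (*-zeroʳ n)))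
  where
  even : ∀ {x i j} → toℕ x ≡ j * 2 + 0 → toℕ i ≡ j →
         minor (𝒟-board n (pos r)) r x w ⇔ Ferrers (choices n ⌊ toℕ r /2⌋) i w
  even {j = j} x≡ refl rewrite x≡ | +-identityʳ (j * 2) = mk⇔
    (λ p → Equivalence.to ⊓⇔ (subst (toℕ w <_) (double j _) (Equivalence.to odd⇔ (s≤s⁻¹ (p (n∣m*n (suc j)))))))
    (λ q _ → s≤s (Equivalence.from odd⇔ (subst (toℕ w <_) (sym (double j _)) (Equivalence.from ⊓⇔ q))))
    where
    odd⇔ = punchIn-≤-odd⇔ r w j
    ⊓⇔ = <-+-⊓-∸⇔ j (suc j + 𝟙[ j < ⌊ toℕ r /2⌋ ]) (toℕ<n w)
    double : ∀ j t → suc (j * 2) + t ≡ j + (suc j + t)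
    double = solve-∀
... | suc zero , j , refl = odd (toℕ-evensFirst n (suc zero) j) (trans (toℕ-combine {2} (suc zero) j) (cong (_+ toℕ j) (*-identityʳ n)))
  where
  odd : ∀ {x i j} → toℕ x ≡ j * 2 + 1 → toℕ i ≡ n + j →
         minor (𝒟-board n (pos r)) r x w ⇔ Ferrers (choices n ⌊ toℕ r /2⌋) i w
  odd {j = j} x≡ i≡ rewrite x≡ | i≡ | +-comm (j * 2) 1 = mk⇔
    (λ _ → Equivalence.to (<-+-⊓-∸⇔ (n + j) _ (toℕ<n w))
      -- The uncapped row length is `2 * n` plus a surplus.
      (<-≤-trans (toℕ<n w) (≤-trans (m≤m+n (2 * n) _) (≤-reflexive (surplus n j _)))))
    (λ _ 2∣odd → contradiction 2∣odd (2∤odd (suc j)))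
    where
    surplus : ∀ n j t → 2 * n + (suc (j + j) + t) ≡ n + j + (suc (n + j) + t)
    surplus = solve-∀

theorem6p1 : ∀ (n r : ℕ) → 1 ≤ n → 1 ≤ r → r ≤ 2 * n + 1 →
    HasCardinality (𝒟 n r) ((n !) ^ 2 * ⌈ r /2⌉)
theorem6p1 n (suc r) _ _ r≤ = subst (HasCardinality (𝒟 n (suc r)))
  -- `⌈ suc r /2⌉` reduces to `suc ⌊ r /2⌋`; the factor 1 being removed is the single choice for the
  -- first row.
  (trans (*-identityˡ _) (prod-choices n ⌊ r /2⌋ h≤n))
  (Composition.inverse (𝒟↔Rooks n (suc r)) (Rooks-expand {k = 1} (𝒟-board n (suc r)) (const v)
    (λ { {zero} {zero} _ → refl })
    (λ _ → cong suc toℕv≡r)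
    (λ u u≡r → zero , toℕ-injective (trans toℕv≡r (sym (suc-injective u≡r))))
    (λ _ → Composition.inverse minor↔Ferrers
      (Ferrers-count (2 * n) _ (choices-step n ⌊ r /2⌋) (choices-end n ⌊ r /2⌋)))))
  where
  r< = subst (suc r ≤_) (+-comm (2 * n) 1) r≤
  v : Fin (suc (2 * n))
  v = fromℕ< r<
  toℕv≡r : toℕ v ≡ r
  toℕv≡r = toℕ-fromℕ< r<
  h≤n : ⌊ r /2⌋ ≤ n
  h≤n = *-cancelʳ-≤ _ n 2 (≤-trans (≤⌊/2⌋⇒≤ r _ ≤-refl) (≤-trans (s≤s⁻¹ r<) (≤-reflexive (*-comm 2 n))))
  minor↔Ferrers : Inverse (Rooks (minor (𝒟-board n (suc r)) v)) (Rooks (Ferrers (choices n ⌊ r /2⌋)))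
  -- The equivalence is available for `pos v`, so it is transported from `toℕ v` to `r`.
  minor↔Ferrers = subst
    (λ s → Inverse (Rooks (minor (𝒟-board n (suc s)) v)) (Rooks (Ferrers (choices n ⌊ s /2⌋))))
    toℕv≡r
    (Rooks-reindex (evensFirst n) {P = minor (𝒟-board n (pos v)) v} (minor-𝒟⇔Ferrers n v))
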